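{- Let $n\ge 3$ and let $BS_n$ be the $n$-dimensional bubble-sort star graph. Then $\mathrm{mp}(BS_n)=2n-3$.
   Context: For a permutation $v=v_1v_2\cdots v_n$ of $[1,n]=\{1,\dots,n\}$ and distinct $i,j\in[1,n]$, $v\circ\langle i,j\rangle$ denotes the permutation obtained from $v$ by exchanging the entries in positions $i$ and $j$. The $n$-dimensional bubble-sort star graph $BS_n$ ($n\ge 2$) has as vertex set all permutations of $[1,n]$, and two distinct vertices $u,v$ are adjacent iff $u=v\circ\langle 1,i\rangle$ for some $i\in[2,n]$, or $u=v\circ\langle i-1,i\rangle$ for some $i\in[3,n]$. A perfect matching covers every vertex; an almost-perfect matching covers all vertices but one. The matching preclusion number $\mathrm{mp}(G)$ is the minimum size of an edge set $F\subseteq E(G)$ such that $G-F$ (delete the edges of $F$, keep all vertices) has neither a perfect matching nor an almost-perfect matching. -}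

module Defs where

open import Level using (0ℓ)
open import Data.Nat using (ℕ; suc; _≤_; _<_)
open import Data.Fin using (Fin; toℕ)
open import Data.Fin.Permutation.Components using (transpose)
open import Data.Vec using (Vec; lookup; tabulate)
open import Data.Product using (Σ; _×_; _,_; proj₁; proj₂; ∃-syntax)
open import Data.Sum using (_⊎_)
open import Data.List using (List; length)
open import Data.List.Relation.Unary.All using (All)
open import Data.List.Relation.Unary.Any using (Any)
open import Data.List.Relation.Unary.AllPairs using (AllPairs)
open import Relation.Nullary using (¬_)
open import Relation.Binary.PropositionalEquality using (_≡_; _≢_)

record Graph : Set₁ where
  field
    V        : Set
    IsVertex : V → Set
    Adj      : V → V → Set   -- adjacency (assumed symmetric by construction)

module _ (G : Graph) where
  open Graph G

  -- an (ordered representative of an undirected) edge of G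
  IsEdge : V × V → Set
  IsEdge (u , v) = IsVertex u × IsVertex v × Adj u v

  SameEdge : V × V → V × V → Set
  SameEdge (a , b) (c , d) = (a ≡ c × b ≡ d) ⊎ (a ≡ d × b ≡ c)

  InEdgeSet : List (V × V) → V × V → Set
  InEdgeSet F e = Any (SameEdge e) F

  Disjoint : V × V → V × V → Set
  Disjoint (a , b) (c , d) = a ≢ c × a ≢ d × b ≢ c × b ≢ d

  IsMatchingAvoiding : List (V × V) → List (V × V) → Set
  IsMatchingAvoiding F M =
    All (λ e → IsEdge e × ¬ InEdgeSet F e) M × AllPairs Disjoint M

  Covers : List (V × V) → V → Set
  Covers M v = Any (λ e → proj₁ e ≡ v ⊎ proj₂ e ≡ v) M

  HasPerfectMatching : List (V × V) → Set
  HasPerfectMatching F = ∃[ M ] (IsMatchingAvoiding F M ×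
    (∀ v → IsVertex v → Covers M v))

  HasAlmostPerfectMatching : List (V × V) → Set
  HasAlmostPerfectMatching F = ∃[ M ] (IsMatchingAvoiding F M ×
    (∃[ w ] (IsVertex w × ¬ Covers M w ×
      (∀ v → IsVertex v → v ≢ w → Covers M v))))

  IsPreclusionSet : List (V × V) → Set
  IsPreclusionSet F = ¬ HasPerfectMatching F × ¬ HasAlmostPerfectMatching F

  MatchingPreclusionNumberIs : ℕ → Set
  MatchingPreclusionNumberIs k =
    (∃[ F ] (All IsEdge F × AllPairs (λ e f → ¬ SameEdge e f) F ×
             length F ≡ k × IsPreclusionSet F))
    × (∀ F → All IsEdge F → length F < k → ¬ IsPreclusionSet F)

-- Bubble-sort star graph BS_n; permutations as vectors v (v_i = lookup v i),
-- positions 0-indexed (position p here = position p+1 in the paper).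

IsPermutation : ∀ {n} → Vec (Fin n) n → Set
IsPermutation v = ∀ i j → lookup v i ≡ lookup v j → i ≡ j

swapPos : ∀ {n} → Vec (Fin n) n → Fin n → Fin n → Vec (Fin n) n
swapPos v i j = tabulate (λ k → lookup v (transpose i j k))

BSAdj : ∀ {n} → Vec (Fin n) n → Vec (Fin n) n → Set
BSAdj {n} u v = u ≢ v ×
  ( (∃[ f ] ∃[ i ] (toℕ f ≡ 0 × 1 ≤ toℕ i × u ≡ swapPos v f i))
  ⊎ (∃[ i ] ∃[ j ] (1 ≤ toℕ i × toℕ j ≡ suc (toℕ i) × u ≡ swapPos v i j)))

BS : ℕ → Graph
BS n = record
  { V = Vec (Fin n) n
  ; IsVertex = IsPermutation
  ; Adj = BSAdj }

{-# OPTIONS --safe #-}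
-- Each of the 2n − 3 generating transpositions t gives a perfect matching
-- M_t = {v, v∘t}, and these matchings are pairwise edge-disjoint.  Fewer than
-- 2n − 3 edges therefore miss some M_t, which survives.  Conversely, deleting the
-- 2n − 3 edges at the identity isolates it: no perfect matching remains, and
-- an almost-perfect one would have to miss exactly the identity, which is excluded
-- because the number of vertices is even (perfect matchings M_t exist).
module Submission where

open import Defs
open import Data.Nat using (ℕ; _≤_; _*_; _∸_; zero; suc; _+_; _<_; z≤n; s≤s)
import Data.Nat.Properties as ℕ
open import Data.Fin as Fin using (Fin; zero; suc; toℕ; inject₁; splitAt)
open import Data.Fin.Properties as Fin
  using (_≟_; _<?_; all?; ¬∀⟶∃¬; pigeonhole; join-splitAt; toℕ-inject₁)
open import Data.Fin.Permutation.Components using (transpose)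
open import Data.Vec using (Vec; []; _∷_; lookup; allFin)
open import Data.Vec.Properties as Vec
  using (lookup∘tabulate; tabulate∘lookup; tabulate-cong; lookup-allFin; ∷-injective)
open import Data.List as List using (List; []; _∷_; length; map; filter; cartesianProductWith)
open import Data.List.Properties using (length-tabulate)
open import Data.List.Membership.Propositional using (_∈_)
open import Data.List.Membership.Propositional.Properties
  using (∈-cartesianProductWith⁺; ∈-allFin; ∈-filter⁺; ∈-map⁺; ∈-lookup)
open import Data.List.Membership.Propositional.Properties.WithK using (unique∧set⇒bag)
open import Data.List.Relation.Binary.BagAndSetEquality using (∼bag⇒↭)
open import Data.List.Relation.Binary.Permutation.Propositional.Properties using (↭-length)
open import Data.List.Relation.Unary.All as All using (All; []; _∷_)
import Data.List.Relation.Unary.All.Properties as All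
open import Data.List.Relation.Unary.AllPairs using (AllPairs; []; _∷_)
import Data.List.Relation.Unary.AllPairs.Properties as AllPairs
open import Data.List.Relation.Unary.Any as Any using (Any; here; there)
import Data.List.Relation.Unary.Any.Properties as Any
open import Data.List.Relation.Unary.Unique.Propositional using (Unique)
import Data.List.Relation.Unary.Unique.Propositional.Properties as Unique
open import Data.Product using (_×_; _,_; proj₁; proj₂; ∃-syntax)
open import Data.Sum using (_⊎_; inj₁; inj₂)
open import Function using (_∘_; mk⇔)
open import Relation.Nullary using (¬_; Dec; yes; no; contradiction; _×-dec_; _→-dec_)
open import Relation.Binary.Definitions using (DecidableEquality; tri<; tri≈; tri>)
open import Relation.Binary.PropositionalEquality
  using (_≡_; _≢_; refl; sym; trans; cong; cong₂; subst; subst₂; ≢-sym; module ≡-Reasoning)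

-- Endpoints of matchings and parity, in an arbitrary graph.

module _ (G : Graph) where
  open Graph G

  endpoints : List (V × V) → List V
  endpoints []            = []
  endpoints ((u , v) ∷ M) = u ∷ v ∷ endpoints M

  length-endpoints : ∀ M → length (endpoints M) ≡ 2 * length M
  length-endpoints []            = refl
  length-endpoints ((u , v) ∷ M) = begin
    2 + length (endpoints M)  ≡⟨ cong (2 +_) (length-endpoints M) ⟩
    2 + 2 * length M          ≡⟨ ℕ.*-suc 2 (length M) ⟨
    2 * suc (length M)        ∎
    where open ≡-Reasoning

  Covers⇒∈endpoints : ∀ {M v} → Covers G M v → v ∈ endpoints M
  Covers⇒∈endpoints (here (inj₁ refl)) = here refl
  Covers⇒∈endpoints (here (inj₂ refl)) = there (here refl)
  Covers⇒∈endpoints (there c)          = there (there (Covers⇒∈endpoints c))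

  ∈endpoints⇒Covers : ∀ {M v} → v ∈ endpoints M → Covers G M v
  ∈endpoints⇒Covers {_ ∷ _} (here refl)         = here (inj₁ refl)
  ∈endpoints⇒Covers {_ ∷ _} (there (here refl)) = here (inj₂ refl)
  ∈endpoints⇒Covers {_ ∷ _} (there (there p))   = there (∈endpoints⇒Covers p)

  endpoints-All : ∀ {P : V → Set} {M} →
    All (λ e → P (proj₁ e) × P (proj₂ e)) M → All P (endpoints M)
  endpoints-All []               = []
  endpoints-All ((pu , pv) ∷ ps) = pu ∷ pv ∷ endpoints-All ps

  module _ (irreflexive : ∀ {u v} → Adj u v → u ≢ v) {F : List (V × V)} where

    -- Irreflexivity separates the two ends of one edge, and `Disjoint` separates the ends of
    -- different edges. The length of the endpoint list therefore counts the covered vertices.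
    endpoints-unique : ∀ {M} → IsMatchingAvoiding G F M → Unique (endpoints M)
    endpoints-unique ([] , []) = []
    endpoints-unique (((_ , _ , adj) , _) ∷ es , ds ∷ dss) =
      (irreflexive adj ∷ endpoints-All (All.map (λ (p , q , _) → p , q) ds)) ∷
      endpoints-All (All.map (λ (_ , _ , p , q) → p , q) ds) ∷
      endpoints-unique (es , dss)

    endpoints-vertices : ∀ {M} → IsMatchingAvoiding G F M → All IsVertex (endpoints M)
    endpoints-vertices (es , _) =
      endpoints-All (All.map (λ ((u , v , _) , _) → u , v) es)

  -- Both endpoint lists are free of repetitions, and `endpoints M` has the same members as
  -- `w ∷ endpoints N`. Hence the lengths agree, and an even number would equal an odd one. Only
  -- vertices are counted, so the deleted sets `F` and `F′` may differ.
  perfect⇒¬almostPerfect : (∀ {u v} → Adj u v → u ≢ v) → DecidableEquality V →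
    ∀ {F F′} → HasPerfectMatching G F → ¬ HasAlmostPerfectMatching G F′
  perfect⇒¬almostPerfect irr _≟V_ (M , isM , cov) (N , isN , w , w-vertex , w∉N , cov′) =
    ℕ.even≢odd (length M) (length N) (begin
      2 * length M                 ≡⟨ length-endpoints M ⟨
      length (endpoints M)         ≡⟨ ↭-length (∼bag⇒↭ (unique∧set⇒bag
                                        (endpoints-unique irr isM) unique′ (mk⇔ to from))) ⟩
      suc (length (endpoints N))   ≡⟨ cong suc (length-endpoints N) ⟩
      suc (2 * length N)           ∎)
    where
    open ≡-Reasoning

    unique′ : Unique (w ∷ endpoints N)
    unique′ = All.¬Any⇒All¬ _ (w∉N ∘ ∈endpoints⇒Covers) ∷ endpoints-unique irr isN

    to : ∀ {v} → v ∈ endpoints M → v ∈ w ∷ endpoints N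
    to {v} v∈M with v ≟V w
    ... | yes v≡w = here v≡w
    ... | no  v≢w = there (Covers⇒∈endpoints
                      (cov′ v (All.lookup (endpoints-vertices irr isM) v∈M) v≢w))

    from : ∀ {v} → v ∈ w ∷ endpoints N → v ∈ endpoints M
    from v∈ = Covers⇒∈endpoints
      (cov _ (All.lookup (w-vertex ∷ endpoints-vertices irr isN) v∈))

-- Enumeration of vectors without repetition.

allVecs : ∀ n k → List (Vec (Fin n) k)
allVecs n zero    = [] ∷ []
allVecs n (suc k) = cartesianProductWith _∷_ (List.allFin n) (allVecs n k)

∈-allVecs : ∀ {n k} (v : Vec (Fin n) k) → v ∈ allVecs n k
∈-allVecs []      = here refl
∈-allVecs (x ∷ v) = ∈-cartesianProductWith⁺ _∷_ (∈-allFin x) (∈-allVecs v)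

allVecs-unique : ∀ n k → Unique (allVecs n k)
allVecs-unique n zero    = [] ∷ []
allVecs-unique n (suc k) =
  Unique.cartesianProductWith⁺ _∷_ ∷-injective (Unique.allFin⁺ n) (allVecs-unique n k)

-- Uniqueness of the enumeration yields only that two listed vertices differ. Disjointness of their
-- matching edges also needs both to be ascending, a property of each entry separately; this lemma
-- combines the two.
AllPairs-strengthen : ∀ {A : Set} {P : A → Set} {R S : A → A → Set} {xs} →
  (∀ x y → P x → P y → R x y → S x y) → All P xs → AllPairs R xs → AllPairs S xs
AllPairs-strengthen f []       []       = []
AllPairs-strengthen f (p ∷ ps) (r ∷ rs) =
  All.zipWith (λ (q , r′) → f _ _ p q r′) (ps , r) ∷ AllPairs-strengthen f ps rs

-- Transpositions acting on positions.

module _ {n : ℕ} where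

  isPermutation? : (v : Vec (Fin n) n) → Dec (IsPermutation v)
  isPermutation? v = all? λ i → all? λ j → (lookup v i ≟ lookup v j) →-dec (i ≟ j)

  _≟ᵥ_ : DecidableEquality (Vec (Fin n) n)
  _≟ᵥ_ = Vec.≡-dec _≟_

  transpose-fst : (i j : Fin n) → transpose i j i ≡ j
  transpose-fst i j with i ≟ i
  ... | yes _  = refl
  ... | no i≢i = contradiction refl i≢i

  transpose-snd : (i j : Fin n) → transpose i j j ≡ i
  transpose-snd i j with j ≟ i
  ... | yes j≡i = j≡i
  ... | no _ with j ≟ j
  ...   | yes _  = refl
  ...   | no j≢j = contradiction refl j≢j

  transpose-cases : (i j k : Fin n) →
    (k ≡ i × transpose i j k ≡ j) ⊎ (k ≡ j × transpose i j k ≡ i) ⊎ transpose i j k ≡ k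
  transpose-cases i j k with k ≟ i
  ... | yes k≡i = inj₁ (k≡i , refl)
  ... | no _ with k ≟ j
  ...   | yes k≡j = inj₂ (inj₁ (k≡j , refl))
  ...   | no _    = inj₂ (inj₂ refl)

  transpose-involutive : (i j k : Fin n) → transpose i j (transpose i j k) ≡ k
  transpose-involutive i j k with transpose-cases i j k
  ... | inj₁ (refl , eq)        = trans (cong (transpose i j) eq) (transpose-snd i j)
  ... | inj₂ (inj₁ (refl , eq)) = trans (cong (transpose i j) eq) (transpose-fst i j)
  ... | inj₂ (inj₂ eq)          = trans (cong (transpose i j) eq) eq

  -- The single position `i` suffices. It is moved, so it is `i′` or `j′`; in the latter case
  -- `j ≡ i′`, and then `i′ < j′ ≡ i < j ≡ i′`, which is absurd.
  transpose-injective : {i j i′ j′ : Fin n} → i Fin.< j → i′ Fin.< j′ →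
    transpose i j i ≡ transpose i′ j′ i → i ≡ i′ × j ≡ j′
  transpose-injective {i} {j} {i′} {j′} i<j i′<j′ eq with transpose-cases i′ j′ i
  ... | inj₁ (i≡i′ , eq′) = i≡i′ , trans (sym (transpose-fst i j)) (trans eq eq′)
  ... | inj₂ (inj₁ (refl , eq′)) = contradiction i′<j′ (Fin.<-asym
          (subst (i Fin.<_) (trans (sym (transpose-fst i j)) (trans eq eq′)) i<j))
  ... | inj₂ (inj₂ eq′) = contradiction
          (trans (sym eq′) (trans (sym eq) (transpose-fst i j))) (Fin.<⇒≢ i<j)

  lookup-swapPos : ∀ v (i j k : Fin n) → lookup (swapPos v i j) k ≡ lookup v (transpose i j k)
  lookup-swapPos v i j k = lookup∘tabulate _ k

  lookup-swapPos-fst : ∀ v (i j : Fin n) → lookup (swapPos v i j) i ≡ lookup v j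
  lookup-swapPos-fst v i j =
    trans (lookup-swapPos v i j i) (cong (lookup v) (transpose-fst i j))

  lookup-swapPos-snd : ∀ v (i j : Fin n) → lookup (swapPos v i j) j ≡ lookup v i
  lookup-swapPos-snd v i j =
    trans (lookup-swapPos v i j j) (cong (lookup v) (transpose-snd i j))

  swapPos-involutive : ∀ v (i j : Fin n) → swapPos (swapPos v i j) i j ≡ v
  swapPos-involutive v i j = trans
    (tabulate-cong λ k → trans (lookup-swapPos v i j _)
                               (cong (lookup v) (transpose-involutive i j k)))
    (tabulate∘lookup v)

  swapPos-flip : ∀ {u v} (i j : Fin n) → u ≡ swapPos v i j → v ≡ swapPos u i j
  swapPos-flip {v = v} i j refl = sym (swapPos-involutive v i j)

  swapPos-injective : ∀ {u v} (i j : Fin n) → swapPos u i j ≡ swapPos v i j → u ≡ v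
  swapPos-injective i j eq = trans (swapPos-flip i j refl) (sym (swapPos-flip i j eq))

  swapPos-isPermutation : ∀ v (i j : Fin n) → IsPermutation v → IsPermutation (swapPos v i j)
  swapPos-isPermutation v i j perm k l eq = begin
    k                                  ≡⟨ transpose-involutive i j k ⟨
    transpose i j (transpose i j k)    ≡⟨ cong (transpose i j) (perm _ _
      (trans (sym (lookup-swapPos v i j k)) (trans eq (lookup-swapPos v i j l)))) ⟩
    transpose i j (transpose i j l)    ≡⟨ transpose-involutive i j l ⟩
    l                                  ∎
    where open ≡-Reasoning

  swapPos-≢ : ∀ v {i j : Fin n} → IsPermutation v → i ≢ j → v ≢ swapPos v i j
  swapPos-≢ v {i} {j} perm i≢j eq = i≢j (perm i j
    (trans (cong (λ u → lookup u i) eq) (lookup-swapPos-fst v i j)))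

  swapPos-determines : ∀ v {i j i′ j′ : Fin n} → IsPermutation v → i Fin.< j → i′ Fin.< j′ →
    swapPos v i j ≡ swapPos v i′ j′ → i ≡ i′ × j ≡ j′
  swapPos-determines v {i} {j} {i′} {j′} perm i<j i′<j′ eq =
    transpose-injective i<j i′<j′ (perm _ _ (begin
      lookup v (transpose i j i)     ≡⟨ lookup-swapPos v i j i ⟨
      lookup (swapPos v i j) i       ≡⟨ cong (λ u → lookup u i) eq ⟩
      lookup (swapPos v i′ j′) i     ≡⟨ lookup-swapPos v i′ j′ i ⟩
      lookup v (transpose i′ j′ i)   ∎))
    where open ≡-Reasoning

  -- Sorts edges into classes by transposition. Since swapping is an involution, the class does not
  -- depend on which endpoint is listed first.
  Swaps : Fin n × Fin n → Vec (Fin n) n × Vec (Fin n) n → Set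
  Swaps (i , j) (u , v) = u ≡ swapPos v i j

  swaps? : ∀ t e → Dec (Swaps t e)
  swaps? (i , j) (u , v) = u ≟ᵥ swapPos v i j

  allFin-isPermutation : IsPermutation (allFin n)
  allFin-isPermutation i j eq =
    trans (sym (lookup-allFin i)) (trans eq (lookup-allFin j))

-- The perfect matching given by one transposition.

module _ {n : ℕ} (i j : Fin n) where

  private
    σ : Vec (Fin n) n → Vec (Fin n) n
    σ v = swapPos v i j

  -- The endpoint listed first is the one with v_i < v_j, so that every edge
  -- {v, σ v} occurs only once.
  Ascending : Vec (Fin n) n → Set
  Ascending v = IsPermutation v × lookup v i Fin.< lookup v j

  ascending? : ∀ v → Dec (Ascending v)
  ascending? v = isPermutation? v ×-dec (lookup v i <? lookup v j)

  swapMatching : List (Vec (Fin n) n × Vec (Fin n) n)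
  swapMatching = map (λ v → v , σ v) (filter ascending? (allVecs n n))

  -- The swap exchanges the values at `i` and `j`, so the image of an ascending vertex is
  -- descending.
  ascending-≢-swapPos : ∀ u v → Ascending u → Ascending v → u ≢ σ v
  ascending-≢-swapPos _ v (_ , u-asc) (_ , v-asc) refl = Fin.<-asym v-asc
    (subst₂ Fin._<_ (lookup-swapPos-fst v i j) (lookup-swapPos-snd v i j) u-asc)

  module _ (i≢j : i ≢ j) (adjacent : ∀ v → IsPermutation v → BSAdj v (σ v)) where

    swapMatching-perfect : ∀ {F} → ¬ Any (Swaps (i , j)) F → HasPerfectMatching (BS n) F
    swapMatching-perfect {F} F-misses =
      swapMatching , (All.map⁺ edges , AllPairs.map⁺ disjoint) , covers
      where
      ascending : All Ascending (filter ascending? (allVecs n n))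
      ascending = All.all-filter ascending? (allVecs n n)

      avoids : ∀ v → ¬ InEdgeSet (BS n) F (v , σ v)
      -- `F` may list the edge in either orientation; the involution takes care of the one starting
      -- at `v`.
      avoids v = F-misses ∘ Any.map λ where
        (inj₁ (refl , refl)) → swapPos-flip i j refl
        (inj₂ (refl , refl)) → refl

      edges : All (λ v → IsEdge (BS n) (v , σ v) × ¬ InEdgeSet (BS n) F (v , σ v))
                  (filter ascending? (allVecs n n))
      edges = All.map
        (λ {v} (perm , _) → (perm , swapPos-isPermutation v i j perm , adjacent v perm) , avoids v)
        ascending

      disjoint : AllPairs (λ u v → Disjoint (BS n) (u , σ u) (v , σ v))
                          (filter ascending? (allVecs n n))
      disjoint = AllPairs-strengthen
        (λ u v u-asc v-asc u≢v → u≢v , ascending-≢-swapPos u v u-asc v-asc ,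
          ≢-sym (ascending-≢-swapPos v u v-asc u-asc) , u≢v ∘ swapPos-injective i j)
        ascending (Unique.filter⁺ ascending? (allVecs-unique n n))

      ∈-swapMatching : ∀ v → Ascending v → (v , σ v) ∈ swapMatching
      ∈-swapMatching v asc = ∈-map⁺ _ (∈-filter⁺ ascending? (∈-allVecs v) asc)

      covers : ∀ v → IsPermutation v → Covers (BS n) swapMatching v
      covers v perm with Fin.<-cmp (lookup v i) (lookup v j)
      ... | tri< v-asc _ _ = Any.map (λ { refl → inj₁ refl }) (∈-swapMatching v (perm , v-asc))
      ... | tri≈ _ eq _    = contradiction (perm i j eq) i≢j
      -- A descending `v` is the second endpoint of the edge listed under the ascending vertex
      -- `σ v`.
      ... | tri> _ _ v-desc = Any.map (λ { refl → inj₂ (swapPos-involutive v i j) })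
        (∈-swapMatching (σ v) (swapPos-isPermutation v i j perm ,
          subst₂ Fin._<_ (sym (lookup-swapPos-fst v i j)) (sym (lookup-swapPos-snd v i j)) v-desc))

-- The generating transpositions of the bubble-sort star graph.

module _ (m : ℕ) where

  private
    n d : ℕ
    n = 2 + m
    d = suc m + m

  -- There are n - 1 star transpositions and n - 2 bubble transpositions, together 2n - 3. The
  -- bubble ones avoid position 0, so the exchange of the first two positions is counted once.
  generator⊎ : Fin (suc m) ⊎ Fin m → Fin n × Fin n
  generator⊎ (inj₁ k) = zero , suc k
  generator⊎ (inj₂ k) = suc (inject₁ k) , suc (suc k)

  generator : Fin d → Fin n × Fin n
  generator = generator⊎ ∘ splitAt (suc m)

  lo hi : Fin d → Fin n
  lo = proj₁ ∘ generator
  hi = proj₂ ∘ generator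

  generator⊎-injective : ∀ {x y} → generator⊎ x ≡ generator⊎ y → x ≡ y
  generator⊎-injective {inj₁ _} {inj₁ _} refl = refl
  generator⊎-injective {inj₂ _} {inj₂ _} eq   =
    cong inj₂ (Fin.suc-injective (Fin.suc-injective (cong proj₂ eq)))
  generator⊎-injective {inj₁ _} {inj₂ _} ()
  generator⊎-injective {inj₂ _} {inj₁ _} ()

  generator-injective : ∀ {k l} → generator k ≡ generator l → k ≡ l
  generator-injective {k} {l} eq = begin
    k                                           ≡⟨ join-splitAt (suc m) m k ⟨
    Fin.join (suc m) m (splitAt (suc m) k)      ≡⟨ cong (Fin.join (suc m) m) (generator⊎-injective eq) ⟩
    Fin.join (suc m) m (splitAt (suc m) l)      ≡⟨ join-splitAt (suc m) m l ⟩
    l                                           ∎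
    where open ≡-Reasoning

  lo<hi : ∀ k → lo k Fin.< hi k
  lo<hi k with splitAt (suc m) k
  ... | inj₁ _ = s≤s z≤n
  ... | inj₂ l = s≤s (s≤s (ℕ.≤-reflexive (toℕ-inject₁ l)))

  swaps-adjacent : ∀ k u v → IsPermutation v → Swaps (generator k) (u , v) → BSAdj u v
  swaps-adjacent k u v perm eq with splitAt (suc m) k | lo<hi k
  ... | inj₁ l | lt = (λ u≡v → swapPos-≢ v perm (Fin.<⇒≢ lt) (trans (sym u≡v) eq)) ,
    inj₁ (zero , suc l , refl , s≤s z≤n , eq)
  ... | inj₂ l | lt = (λ u≡v → swapPos-≢ v perm (Fin.<⇒≢ lt) (trans (sym u≡v) eq)) ,
    inj₂ (suc (inject₁ l) , suc (suc l) , s≤s z≤n , cong (2 +_) (sym (toℕ-inject₁ l)) , eq)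

  generator-adjacent : ∀ k v → IsPermutation v → BSAdj v (swapPos v (lo k) (hi k))
  generator-adjacent k v perm = swaps-adjacent k v _
    (swapPos-isPermutation v (lo k) (hi k) perm) (swapPos-flip (lo k) (hi k) refl)

  adjacent-swaps⊎ : ∀ u v → BSAdj u v → ∃[ x ] Swaps (generator⊎ x) (u , v)
  adjacent-swaps⊎ u v (_ , inj₁ (zero , suc i , _ , _ , eq)) = inj₁ i , eq
  adjacent-swaps⊎ u v (_ , inj₂ (suc i , suc (suc j) , _ , j≡1+i , eq)) = inj₂ j ,
    -- Adjacency relates the two positions only through `toℕ`; comparing values identifies `i` with
    -- `inject₁ j`.
    trans eq (cong (λ l → swapPos v (suc l) (suc (suc j))) (Fin.toℕ-injective
      (trans (sym (ℕ.suc-injective (ℕ.suc-injective j≡1+i))) (sym (toℕ-inject₁ j)))))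

  adjacent-swaps : ∀ u v → BSAdj u v → ∃[ k ] Swaps (generator k) (u , v)
  adjacent-swaps u v adj with x , eq ← adjacent-swaps⊎ u v adj =
    Fin.join (suc m) m x ,
    subst (λ y → Swaps (generator⊎ y) (u , v)) (sym (Fin.splitAt-join (suc m) m x)) eq

  -- This is the edge-disjointness of the matchings of different generators.
  swaps-determine : ∀ {k l} e → IsPermutation (proj₂ e) →
    Swaps (generator k) e → Swaps (generator l) e → k ≡ l
  swaps-determine {k} {l} (_ , v) perm eq eq′ = generator-injective
    (let p , q = swapPos-determines v perm (lo<hi k) (lo<hi l) (trans (sym eq) eq′) in cong₂ _,_ p q)

  -- Lower bound: fewer than 2n - 3 edges do not suffice.

  generator-perfect : ∀ k {F} → ¬ Any (Swaps (generator k)) F → HasPerfectMatching (BS n) F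
  generator-perfect k = swapMatching-perfect (lo k) (hi k) (Fin.<⇒≢ (lo<hi k))
    (generator-adjacent k)

  -- Send each generator to the index in `F` of an edge in its class. There are fewer than `d`
  -- indices, so two generators share an edge, yet an edge determines its generator.
  few-edges-miss-generator : ∀ {F} → All (IsEdge (BS n)) F → length F < d →
    ¬ (∀ k → Any (Swaps (generator k)) F)
  few-edges-miss-generator {F} edges |F|<d hits
    with k , l , k<l , same ← pigeonhole |F|<d (Any.index ∘ hits) =
    Fin.<⇒≢ k<l (swaps-determine (List.lookup F (Any.index (hits l))) v-perm
      (subst (λ x → Swaps (generator k) (List.lookup F x)) same (Any.lookup-index (hits k)))
      (Any.lookup-index (hits l)))
    where
    v-perm = proj₁ (proj₂ (All.lookup edges (∈-lookup (Any.index (hits l)))))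

  few-edges-not-preclusion : ∀ F → All (IsEdge (BS n)) F → length F < d →
    ¬ IsPreclusionSet (BS n) F
  few-edges-not-preclusion F edges |F|<d (no-perfect , _)
    -- Decidability of `Swaps` turns the impossibility of hitting every class into an explicit
    -- missed generator.
    with k , misses ← ¬∀⟶∃¬ d _ (λ k → Any.any? (swaps? (generator k)) F)
                        (few-edges-miss-generator edges |F|<d) =
    no-perfect (generator-perfect k misses)

  -- Upper bound: deleting all edges at the identity.

  ray : Fin d → Vec (Fin n) n × Vec (Fin n) n
  ray k = allFin n , swapPos (allFin n) (lo k) (hi k)

  star : List (Vec (Fin n) n × Vec (Fin n) n)
  star = List.tabulate ray

  star-edges : All (IsEdge (BS n)) star
  star-edges = All.tabulate⁺ {f = ray} λ k →
    allFin-isPermutation , swapPos-isPermutation (allFin n) (lo k) (hi k) allFin-isPermutation ,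
    generator-adjacent k (allFin n) allFin-isPermutation

  star-distinct : AllPairs (λ e f → ¬ SameEdge (BS n) e f) star
  star-distinct = AllPairs.tabulate⁺ {f = ray} λ {k} {l} k≢l → λ where
    (inj₁ (_ , eq)) → k≢l (swaps-determine (_ , allFin n) allFin-isPermutation refl eq)
    -- If two rays agreed with opposite orientations, the identity would be its own neighbour.
    (inj₂ (eq , _)) → swapPos-≢ (allFin n) allFin-isPermutation (Fin.<⇒≢ (lo<hi l)) eq

  -- Every adjacency comes from a generator, so each edge at the identity is one of the rays up to
  -- orientation, and a matching edge avoiding `star` cannot touch it.
  star-isolates : ∀ {M} → IsMatchingAvoiding (BS n) star M → ¬ Covers (BS n) M (allFin n)
  star-isolates {M} (edges , _) cov = All.All¬⇒¬Any (All.map unmatched edges) cov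
    where
    unmatched : ∀ {e} → IsEdge (BS n) e × ¬ InEdgeSet (BS n) star e →
      ¬ (proj₁ e ≡ allFin n ⊎ proj₂ e ≡ allFin n)
    unmatched {u , v} ((_ , _ , adj) , avoids) incident with adjacent-swaps u v adj | incident
    ... | k , eq | inj₁ refl =
      avoids (Any.tabulate⁺ {f = ray} k (inj₁ (refl , swapPos-flip (lo k) (hi k) eq)))
    ... | k , eq | inj₂ refl = avoids (Any.tabulate⁺ {f = ray} k (inj₂ (eq , refl)))

  star-preclusion : IsPreclusionSet (BS n) star
  star-preclusion =
    (λ (_ , isM , cov) → star-isolates isM (cov (allFin n) allFin-isPermutation)) ,
    -- Parity needs one perfect matching of any kind; the one of the first generator in the
    -- undeleted graph serves.
    perfect⇒¬almostPerfect (BS n) proj₁ _≟ᵥ_ (generator-perfect zero {F = []} λ ())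

  mp-BS : MatchingPreclusionNumberIs (BS n) d
  mp-BS = (star , star-edges , star-distinct , length-tabulate ray , star-preclusion) ,
    few-edges-not-preclusion

2*[2+m]∸3 : ∀ m → suc m + m ≡ 2 * (2 + m) ∸ 3
2*[2+m]∸3 m = sym (begin
  (m + (2 + (m + 0))) ∸ 1   ≡⟨ cong (_∸ 1) (ℕ.+-suc m _) ⟩
  m + suc (m + 0)           ≡⟨ ℕ.+-suc m _ ⟩
  suc (m + (m + 0))         ≡⟨ cong (suc m +_) (ℕ.+-identityʳ m) ⟩
  suc m + m                 ∎)
  where open ≡-Reasoning

theorem3p3 : ∀ (n : ℕ) → 3 ≤ n → MatchingPreclusionNumberIs (BS n) (2 * n ∸ 3)
theorem3p3 (suc (suc m)) (s≤s (s≤s _)) =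
  subst (MatchingPreclusionNumberIs (BS (2 + m))) (2*[2+m]∸3 m) (mp-BS m)
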